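{- Let $k$ be a field with $\mathrm{char}\,k\ne3$ and let $M\supset k$ be a Hilbertian field. Then for a fixed $a\in M$ with $a(4a+27)\neq0$ there exist infinitely many $b\in M$ such that $\mathrm{Spl}_M(X^3+aX+a)=\mathrm{Spl}_M(X^3+bX+b)$.
   Context: $\mathrm{Spl}_M f$ denotes the splitting field of $f$ over $M$ in a fixed algebraic closure of $M$. The discriminant of $X^3+aX+a$ is $-a^2(4a+27)$. -}

module Defs where

open import Level using (Level; _⊔_)
import Level
open import Data.Nat.Base as ℕ using (ℕ; zero; suc)
import Data.Nat.Divisibility as ℕ
open import Data.List.Base using (List; []; _∷_; map)
open import Data.List.Relation.Unary.All using (All)
open import Data.Product.Base using (_×_; Σ-syntax; ∃-syntax)
open import Function.Bundles using (_⇔_)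
open import Relation.Unary using (Pred)
open import Algebra.Bundles using (CommutativeRing)
open import Algebra.Bundles.Raw using (RawRing)
open import Algebra.Apartness.Bundles using (HeytingField; HeytingCommutativeRing)
open import Algebra.Morphism.Structures using (IsRingMonomorphism)
import Algebra.Definitions.RawSemiring as RawSemiringDefinitions

-- A field is a `HeytingField`, and "x ≠ y" is its apartness relation x # y.
-- With excluded middle, x # y is the negation of x ≈ y (by `tight`), and these
-- are exactly the usual fields.

rawRing : ∀ {c ℓ₁ ℓ₂} → HeytingField c ℓ₁ ℓ₂ → RawRing c ℓ₁
rawRing K = CommutativeRing.rawRing
  (HeytingCommutativeRing.commutativeRing (HeytingField.heytingCommutativeRing K))

numeral : ∀ {c ℓ₁ ℓ₂} (K : HeytingField c ℓ₁ ℓ₂) → ℕ → HeytingField.Carrier K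
numeral K n = n · 1#
  where
  open RawRing (rawRing K) using (1#; rawSemiring)
  open RawSemiringDefinitions rawSemiring using () renaming (_×_ to _·_)

HasCharacteristic : ∀ {c ℓ₁ ℓ₂} → HeytingField c ℓ₁ ℓ₂ → ℕ → Set ℓ₁
HasCharacteristic K p = ∀ n → (numeral K n ≈ 0#) ⇔ (p ℕ.∣ n)
  where open HeytingField K using (_≈_; 0#)

-- P holds for infinitely many elements: outside any finite list of elements
-- there is a further one satisfying P.
InfinitelyMany : ∀ {c ℓ₁ ℓ₂ p} (K : HeytingField c ℓ₁ ℓ₂) →
                 Pred (HeytingField.Carrier K) p → Set (c ⊔ ℓ₂ ⊔ p)
InfinitelyMany K P = ∀ (xs : List Carrier) → ∃[ x ] P x × All (x #_) xs
  where open HeytingField K using (Carrier; _#_)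

-- Polynomials are lists of coefficients, constant term first.  Trailing zeros
-- are allowed; `_≈ᴾ_` compares coefficients and so ignores them.
module Polynomial {c ℓ} (R : RawRing c ℓ) where
  open RawRing R

  Poly : Set c
  Poly = List Carrier

  coeff : Poly → ℕ → Carrier
  coeff []      _       = 0#
  coeff (a ∷ p) zero    = a
  coeff (a ∷ p) (suc n) = coeff p n

  eval : Poly → Carrier → Carrier
  eval []      x = 0#
  eval (a ∷ p) x = a + x * eval p x

  infix  4 _≈ᴾ_
  infixl 6 _+ᴾ_
  infixl 7 _*ᴾ_

  _≈ᴾ_ : Poly → Poly → Set ℓ
  p ≈ᴾ q = ∀ n → coeff p n ≈ coeff q n

  _+ᴾ_ : Poly → Poly → Poly
  []      +ᴾ q       = q
  (a ∷ p) +ᴾ []      = a ∷ p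
  (a ∷ p) +ᴾ (b ∷ q) = (a + b) ∷ (p +ᴾ q)

  _*ᴾ_ : Poly → Poly → Poly
  []      *ᴾ q = []
  (a ∷ p) *ᴾ q = map (a *_) q +ᴾ (0# ∷ (p *ᴾ q))

  -- (a + X p)′ = p + X p′
  derivative : Poly → Poly
  derivative []      = []
  derivative (a ∷ p) = p +ᴾ (0# ∷ derivative p)

  polyRing : RawRing c ℓ
  polyRing = record
    { Carrier = Poly
    ; _≈_     = _≈ᴾ_
    ; _+_     = _+ᴾ_
    ; _*_     = _*ᴾ_
    ; -_      = map -_
    ; 0#      = []
    ; 1#      = 1# ∷ []
    }

Irreducible : ∀ {c ℓ} (R : RawRing c ℓ) → RawRing.Carrier R → Set (c ⊔ ℓ)
Irreducible R = RawSemiringDefinitions.Irreducible (RawRing.rawSemiring R)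

module _ {c ℓ₁ ℓ₂} (K : HeytingField c ℓ₁ ℓ₂) where
  open HeytingField K using (Carrier; _#_; 0#)

  private
    module K[T]    = Polynomial (rawRing K)
    module K[T][X] = Polynomial K[T].polyRing

  NonzeroPoly : K[T].Poly → Set ℓ₂
  NonzeroPoly p = ∃[ n ] (K[T].coeff p n # 0#)

  NonconstantPoly : K[T].Poly → Set ℓ₂
  NonconstantPoly p = ∃[ n ] (K[T].coeff p (suc n) # 0#)

  PositiveDegreeInX : K[T][X].Poly → Set ℓ₂
  PositiveDegreeInX f = ∃[ n ] NonzeroPoly (K[T][X].coeff f (suc n))

  -- f and ∂f/∂X are coprime in K(T)[X]: a Bézout identity u f + v ∂f/∂X = 1
  -- over K(T), multiplied by a common denominator d ∈ K[T] ∖ {0}.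
  SeparableInX : K[T][X].Poly → Set (c ⊔ ℓ₁ ⊔ ℓ₂)
  SeparableInX f =
    Σ[ u ∈ K[T][X].Poly ] Σ[ v ∈ K[T][X].Poly ] Σ[ d ∈ K[T].Poly ]
      NonzeroPoly d ×
      ((u K[T][X].*ᴾ f) K[T][X].+ᴾ (v K[T][X].*ᴾ K[T][X].derivative f))
        K[T][X].≈ᴾ (d ∷ [])

  specialise : K[T][X].Poly → Carrier → K[T].Poly
  specialise f t = map (λ p → K[T].eval p t) f

  -- The separable notion of Hilbertian, which agrees with the older one (all
  -- irreducible f of positive X-degree) in characteristic 0 and is weaker, hence
  -- more general, in characteristic p.
  Hilbertian : Set (c ⊔ ℓ₁ ⊔ ℓ₂)
  Hilbertian = ∀ (f : K[T][X].Poly) →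
    Irreducible K[T][X].polyRing f → PositiveDegreeInX f → SeparableInX f →
    InfinitelyMany K (λ t → Irreducible K[T].polyRing (specialise f t))

record AlgebraicClosure {c ℓ₁ ℓ₂} (M : HeytingField c ℓ₁ ℓ₂) (c′ ℓ₁′ ℓ₂′ : Level) :
    Set (c ⊔ ℓ₁ ⊔ ℓ₂ ⊔ Level.suc (c′ ⊔ ℓ₁′ ⊔ ℓ₂′)) where
  field
    Ω : HeytingField c′ ℓ₁′ ℓ₂′

  private
    module M = HeytingField M
    module Ω = HeytingField Ω
    module M[X] = Polynomial (rawRing M)
    module Ω[X] = Polynomial (rawRing Ω)

  field
    ι                : M.Carrier → Ω.Carrier
    ι-isMonomorphism : IsRingMonomorphism (rawRing M) (rawRing Ω) ι

  IsRootOf : M[X].Poly → Pred Ω.Carrier ℓ₁′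
  IsRootOf f x = Ω[X].eval (map ι f) x Ω.≈ Ω.0#

  field
    algebraic           : ∀ x → Σ[ f ∈ M[X].Poly ] NonzeroPoly M f × IsRootOf f x
    algebraicallyClosed : ∀ (f : Ω[X].Poly) → NonconstantPoly Ω f →
                          ∃[ x ] (Ω[X].eval f x Ω.≈ Ω.0#)

module _ {c ℓ₁ ℓ₂ c′ ℓ₁′ ℓ₂′} {M : HeytingField c ℓ₁ ℓ₂}
         (closure : AlgebraicClosure M c′ ℓ₁′ ℓ₂′) where
  open AlgebraicClosure closure using (Ω; ι; IsRootOf)
  open HeytingField Ω

  data Adjoin {s} (S : Pred Carrier s) : Pred Carrier (c ⊔ c′ ⊔ ℓ₁′ ⊔ s) where
    base    : ∀ m → Adjoin S (ι m)
    gen     : ∀ {x} → S x → Adjoin S x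
    add     : ∀ {x y} → Adjoin S x → Adjoin S y → Adjoin S (x + y)
    mul     : ∀ {x y} → Adjoin S x → Adjoin S y → Adjoin S (x * y)
    neg     : ∀ {x} → Adjoin S x → Adjoin S (- x)
    inv     : ∀ {x y} → x * y ≈ 1# → Adjoin S x → Adjoin S y
    respect : ∀ {x y} → x ≈ y → Adjoin S x → Adjoin S y

  -- As f splits in Ω, its splitting field over M inside Ω is the subfield
  -- generated by M and the roots of f in Ω.
  Spl : Polynomial.Poly (rawRing M) → Pred Carrier (c ⊔ c′ ⊔ ℓ₁′)
  Spl f = Adjoin (IsRootOf f)

cubic : ∀ {c ℓ₁ ℓ₂} (K : HeytingField c ℓ₁ ℓ₂) →
        HeytingField.Carrier K → Polynomial.Poly (rawRing K)
cubic K a = a ∷ a ∷ 0# ∷ 1# ∷ []   -- X³ + a X + a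
  where open HeytingField K using (0#; 1#)

{-# OPTIONS --safe #-}

-- Let θ be a root of X³ + aX + a.  For a parameter u, the element
-- η = θ + u(3θ² + 2a) has trace zero and is a root of X³ + PX + Q, where P and Q
-- are polynomials in a and u.  Rescaling, y = (P/Q)η is a root of X³ + bX + b with
-- b = P³/Q².  Conversely D θ is a polynomial in η over M, where D is the index of
-- M[η] in M[θ]; the formula for θ in terms of y turns any root of X³ + bX + b into a
-- root of X³ + aX + a.  Thus the splitting fields agree as soon as P, Q, D ≠ 0 at u.
-- Moreover b ≠ x means that P³ − x Q² ≠ 0, and this polynomial in u is not zero,
-- because its two lowest coefficients c₀, c₁ satisfy 4a c₀ + c₁ = a³(4a + 27).
-- Hence finitely many nonzero polynomials in u have to be kept from vanishing, and
-- Hilbertianity is only needed, for the irreducible polynomial X, to see that M is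
-- infinite.
module Submission where

open import Defs
open import Relation.Nullary using (¬_; yes; no)
open import Relation.Unary using (Pred; _⊆_; _≐_)
open import Algebra.Apartness.Bundles using (HeytingField; HeytingCommutativeRing)
open import Algebra.Bundles using (CommutativeMonoid; CommutativeRing)
open import Algebra.Bundles.Raw using (RawRing)
open import Algebra.Definitions using (Commutative)
import Algebra.Definitions.RawMagma as RawMagmaDefinitions
open import Algebra.Definitions.RawSemiring using (mkIrred)
open import Algebra.Morphism.Structures using (IsRingMonomorphism)
open import Algebra.Solver.Ring.AlmostCommutativeRing
  using (_-Raw-AlmostCommutative⟶_; fromCommutativeRing)
open import Algebra.Structures using (IsCommutativeMonoid)
open import Data.Empty using (⊥-elim)
open import Data.Integer.Base as ℤ using (ℤ; +_; -[1+_]; _⊖_; _◃_)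
import Data.Integer.Properties as ℤ
open import Data.List.Base using (List; []; _∷_; map; length)
open import Data.List.Relation.Binary.Pointwise.Base using (Pointwise; []; _∷_)
open import Data.List.Relation.Unary.All as All using (All; []; _∷_)
open import Data.Maybe.Base using (Maybe; just; nothing)
open import Data.Nat.Base as ℕ using (ℕ; zero; suc)
open import Data.Product.Base using (_×_; _,_; ∃-syntax; proj₁; proj₂)
open import Data.Sign.Base as Sign using ()
open import Data.Sum.Base as Sum using (_⊎_; inj₁; inj₂; [_,_]′)
open import Data.Unit.Base using (⊤)
open import Function.Base using (_∘_)
open import Relation.Binary.PropositionalEquality.Core as ≡ using (_≡_)
import Relation.Binary.Reasoning.Setoid as ≈-Reasoning

-- A ring solver with integer coefficients.

module IntegerCoefficients {c ℓ} (R : CommutativeRing c ℓ) where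
  open CommutativeRing R
  open import Algebra.Properties.Ring ring
  open import Algebra.Properties.AbelianGroup +-abelianGroup using (⁻¹-∙-comm)
  open import Algebra.Properties.Semiring.Mult semiring renaming (_×_ to _·_)
  open import Algebra.Properties.CommutativeSemigroup +-commutativeSemigroup using (interchange)
  open import Relation.Binary.Reasoning.Setoid setoid

  -- The canonical homomorphism from ℤ. With it the solver constant `con (+ n)` denotes `n · 1#`,
  -- the form in which numerals occur in the formulas below.
  fromℤ : ℤ → Carrier
  fromℤ (+ n)    = n · 1#
  fromℤ -[1+ n ] = - (suc n · 1#)

  fromℤ-⊖ : ∀ m n → fromℤ (m ⊖ n) ≈ m · 1# - n · 1#
  fromℤ-⊖ zero    zero    = sym (-‿inverseʳ 0#)
  fromℤ-⊖ zero    (suc n) = sym (+-identityˡ _)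
  fromℤ-⊖ (suc m) zero    = sym (trans (+-congˡ -0#≈0#) (+-identityʳ _))
  fromℤ-⊖ (suc m) (suc n) = begin
    fromℤ (suc m ⊖ suc n)             ≡⟨ ≡.cong fromℤ (ℤ.[1+m]⊖[1+n]≡m⊖n m n) ⟩
    fromℤ (m ⊖ n)                     ≈⟨ fromℤ-⊖ m n ⟩
    m · 1# - n · 1#                   ≈⟨ +-identityˡ _ ⟨
    0# + (m · 1# - n · 1#)            ≈⟨ +-congʳ (-‿inverseʳ 1#) ⟨
    (1# - 1#) + (m · 1# - n · 1#)     ≈⟨ interchange _ _ _ _ ⟩
    (1# + m · 1#) + (- 1# - n · 1#)   ≈⟨ +-congˡ (⁻¹-∙-comm _ _) ⟩
    suc m · 1# - suc n · 1#           ∎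

  fromℤ-+◃ : ∀ n → fromℤ (Sign.+ ◃ n) ≈ n · 1#
  fromℤ-+◃ zero    = refl
  fromℤ-+◃ (suc n) = refl

  fromℤ--◃ : ∀ n → fromℤ (Sign.- ◃ n) ≈ - (n · 1#)
  fromℤ--◃ zero    = sym -0#≈0#
  fromℤ--◃ (suc n) = refl

  fromℤ-+ : ∀ i j → fromℤ (i ℤ.+ j) ≈ fromℤ i + fromℤ j
  fromℤ-+ (+ m)    (+ n)    = ×-homo-+ 1# m n
  fromℤ-+ (+ m)    -[1+ n ] = fromℤ-⊖ m (suc n)
  fromℤ-+ -[1+ m ] (+ n)    = trans (fromℤ-⊖ n (suc m)) (+-comm _ _)
  fromℤ-+ -[1+ m ] -[1+ n ] = begin
    - (suc (suc (m ℕ.+ n)) · 1#)       ≈⟨ -‿cong (+-congˡ (×-homo-+ 1# (suc m) n)) ⟩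
    - (1# + (suc m · 1# + n · 1#))     ≈⟨ -‿cong (x∙yz≈y∙xz 1# (suc m · 1#) (n · 1#)) ⟩
    - (suc m · 1# + suc n · 1#)        ≈⟨ ⁻¹-∙-comm _ _ ⟨
    - (suc m · 1#) - suc n · 1#        ∎
    where open import Algebra.Properties.CommutativeSemigroup +-commutativeSemigroup using (x∙yz≈y∙xz)

  fromℤ-* : ∀ i j → fromℤ (i ℤ.* j) ≈ fromℤ i * fromℤ j
  fromℤ-* (+ m)    (+ n)    = trans (fromℤ-+◃ (m ℕ.* n)) (×1-homo-* m n)
  fromℤ-* (+ m)    -[1+ n ] = begin
    fromℤ (Sign.- ◃ m ℕ.* suc n)  ≈⟨ fromℤ--◃ (m ℕ.* suc n) ⟩
    - ((m ℕ.* suc n) · 1#)        ≈⟨ -‿cong (×1-homo-* m (suc n)) ⟩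
    - (m · 1# * suc n · 1#)       ≈⟨ -‿distribʳ-* _ _ ⟩
    m · 1# * - (suc n · 1#)       ∎
  fromℤ-* -[1+ m ] (+ n)    = begin
    fromℤ (Sign.- ◃ suc m ℕ.* n)  ≈⟨ fromℤ--◃ (suc m ℕ.* n) ⟩
    - ((suc m ℕ.* n) · 1#)        ≈⟨ -‿cong (×1-homo-* (suc m) n) ⟩
    - (suc m · 1# * n · 1#)       ≈⟨ -‿distribˡ-* _ _ ⟩
    - (suc m · 1#) * n · 1#       ∎
  fromℤ-* -[1+ m ] -[1+ n ] = begin
    (suc m ℕ.* suc n) · 1#           ≈⟨ ×1-homo-* (suc m) (suc n) ⟩
    suc m · 1# * suc n · 1#          ≈⟨ -‿involutive _ ⟨
    - - (suc m · 1# * suc n · 1#)    ≈⟨ -‿cong (-‿distribʳ-* _ _) ⟩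
    - (suc m · 1# * - (suc n · 1#))  ≈⟨ -‿distribˡ-* _ _ ⟩
    - (suc m · 1#) * - (suc n · 1#)  ∎

  fromℤ-neg : ∀ i → fromℤ (ℤ.- i) ≈ - fromℤ i
  fromℤ-neg (+ zero)  = sym -0#≈0#
  fromℤ-neg (+ suc n) = refl
  fromℤ-neg -[1+ n ]  = sym (-‿involutive _)

  morphism : CommutativeRing.rawRing ℤ.+-*-commutativeRing
             -Raw-AlmostCommutative⟶ fromCommutativeRing R
  morphism = record
    { ⟦_⟧    = fromℤ
    ; +-homo = fromℤ-+
    ; *-homo = fromℤ-*
    ; -‿homo = fromℤ-neg
    ; 0-homo = refl
    ; 1-homo = +-identityʳ 1#
    }

  -- Distinct integers may coincide in `R` when the characteristic is positive, so inequality in ℤ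
  -- yields `nothing` and no refutation.
  fromℤ-≟ : ∀ i j → Maybe (fromℤ i ≈ fromℤ j)
  fromℤ-≟ i j with i ℤ.≟ j
  ... | yes ≡.refl = just refl
  ... | no  _      = nothing

  open import Algebra.Solver.Ring _ _ morphism fromℤ-≟ public

-- The Tschirnhaus transformation of X³ + aX + a.

module Tschirnhaus {c ℓ} (R : CommutativeRing c ℓ) where
  open CommutativeRing R hiding (rawRing)
  open Defs.Polynomial (CommutativeRing.rawRing R)
  open import Algebra.Properties.Semiring.Mult semiring renaming (_×_ to _·_)
  open IntegerCoefficients R
    using (solve; _:=_; con; _:+_; _:*_; _:-_; :-_; _:^_) renaming (Polynomial to Expr)
  open import Relation.Binary.Reasoning.Setoid setoid

  -- Polynomials in u, obtained by reducing powers of η modulo θ³ = -aθ - a. `D` is the determinant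
  -- of (1, η, η²) with respect to (1, θ, θ²).
  P Q D : Carrier → Poly
  P a = a ∷ 9 · 1# * a ∷ - (3 · 1# * (a * a)) ∷ []
  Q a = a ∷ - (2 · 1# * (a * a)) ∷ - (9 · 1# * (a * a)) ∷
        - (27 · 1# * (a * a) + 2 · 1# * (a * (a * a))) ∷ []
  D a = 1# ∷ 0# ∷ 9 · 1# * a ∷ 27 · 1# * a ∷ []

  -- P³ - x Q² expanded in powers of u, so that its coefficients can be inspected.
  E : Carrier → Carrier → Poly
  E a x =
    a * (a * (a - x)) ∷
    a * (a * (a * (27 · 1# + 4 · 1# * x))) ∷
    a * (a * (a * (243 · 1# - 9 · 1# * a + (18 · 1# - 4 · 1# * a) * x))) ∷
    a * (a * (a * (729 · 1# - 162 · 1# * a + (54 · 1# - 32 · 1# * a) * x))) ∷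
    a * (a * (a * (a * (27 · 1# * a - 729 · 1# - (189 · 1# + 8 · 1# * a) * x)))) ∷
    a * (a * (a * (a * (243 · 1# * a - (486 · 1# + 36 · 1# * a) * x)))) ∷
    - (a * (a * (a * (a * (27 · 1# * (a * a) + (729 · 1# + 108 · 1# * a + 4 · 1# * (a * a)) * x))))) ∷
    []

  trinomial : Carrier → Carrier → Carrier → Carrier
  trinomial p q x = x * (x * x) + p * x + q

  -- The sum of the squared roots is -2a, so the summand 2a makes the correction term trace-free.
  transform : Carrier → Carrier → Carrier → Carrier
  transform a u θ = θ + u * (3 · 1# * (θ * θ) + 2 · 1# * a)

  -- The combination of η and η² in which θ² cancels; the last summand removes the constant term.
  untransform : Carrier → Carrier → Carrier → Carrier
  untransform a u η =
    (1# + 3 · 1# * (a * (u * u))) * η - 3 · 1# * (u * (η * η)) - 2 · 1# * (u * eval (P a) u)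

  private
    infix 10 #_
    #_ : ∀ {n} → ℕ → Expr n
    # k = con (+ k)

    -- con (+ 1) denotes 1# + 0#, whereas a zeroth power denotes 1# itself.
    :1 : ∀ {n} → Expr n
    :1 = # 0 :^ 0

    -- These follow the unfolding of `eval` literally, including the final `u :* # 0`, so that
    -- solved identities match their goals by computation.
    :P :Q :D : ∀ {n} (a u : Expr n) → Expr n
    :P a u = a :+ u :* (# 9 :* a :+ u :* (:- (# 3 :* (a :* a)) :+ u :* # 0))
    :Q a u = a :+ u :* (:- (# 2 :* (a :* a)) :+ u :* (:- (# 9 :* (a :* a)) :+
             u :* (:- (# 27 :* (a :* a) :+ # 2 :* (a :* (a :* a))) :+ u :* # 0)))
    :D a u = :1 :+ u :* (# 0 :+ u :* (# 9 :* a :+ u :* (# 27 :* a :+ u :* # 0)))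

    :trinomial : ∀ {n} (p q x : Expr n) → Expr n
    :trinomial p q x = x :* (x :* x) :+ p :* x :+ q

    :transform :untransform : ∀ {n} (a u x : Expr n) → Expr n
    :transform a u θ = θ :+ u :* (# 3 :* (θ :* θ) :+ # 2 :* a)
    :untransform a u η =
      (:1 :+ # 3 :* (a :* (u :* u))) :* η :- # 3 :* (u :* (η :* η)) :- # 2 :* (u :* :P a u)

    -- Cofactors, obtained by dividing by the cubics that are monic in the last variable.
    :C₁ :C₂ :C₃ :C₄ :C₅ : ∀ {n} (a u x : Expr n) → Expr n
    :C₁ a u θ = # 27 :* (u :* (u :* (u :* (θ :* (θ :* θ))))) :+ # 27 :* (u :* (u :* (θ :* θ)))
      :+ (# 9 :* u :+ # 27 :* (a :* (u :* (u :* u)))) :* θ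
      :+ (# 1 :+ # 9 :* (a :* (u :* u)) :- # 27 :* (a :* (u :* (u :* u))))
    :C₂ a u θ = :- (# 18 :* (u :* u) :+ # 27 :* (u :* (u :* u)) :* θ)
    :C₃ a u η = # 9 :* (u :* u) :* η :- # 6 :* u :* (# 1 :+ # 3 :* (a :* (u :* u)))
    :C₄ a u η = # 1 :- # 3 :* (u :* η) :- # 3 :* (a :* (u :* u)) :- # 27 :* (a :* (u :* (u :* u)))
    :C₅ a u η = :D a u :* :C₄ a u η :+ :untransform a u η :* :C₃ a u η

    :E : ∀ {n} (a u x : Expr n) → Expr n
    :E a u x =
      a :* (a :* (a :- x)) :+ u :* (
      a :* (a :* (a :* (# 27 :+ # 4 :* x))) :+ u :* (
      a :* (a :* (a :* (# 243 :- # 9 :* a :+ (# 18 :- # 4 :* a) :* x))) :+ u :* (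
      a :* (a :* (a :* (# 729 :- # 162 :* a :+ (# 54 :- # 32 :* a) :* x))) :+ u :* (
      a :* (a :* (a :* (a :* (# 27 :* a :- # 729 :- (# 189 :+ # 8 :* a) :* x)))) :+ u :* (
      a :* (a :* (a :* (a :* (# 243 :* a :- (# 486 :+ # 36 :* a) :* x)))) :+ u :* (
      :- (a :* (a :* (a :* (a :* (# 27 :* (a :* a) :+ (# 729 :+ # 108 :* a :+ # 4 :* (a :* a)) :* x))))) :+
      u :* # 0))))))

  eval-E : ∀ a u x → eval (E a x) u ≈
    eval (P a) u * (eval (P a) u * eval (P a) u) - x * (eval (Q a) u * eval (Q a) u)
  eval-E a u x = solve 3 (λ a u x →
    :E a u x := :P a u :* (:P a u :* :P a u) :- x :* (:Q a u :* :Q a u)) refl a u x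

  -- The weight 4a is chosen to eliminate `x`, which enters the two coefficients as -a²x and 4a³x.
  E-coefficients : ∀ a x → 4 · 1# * a * coeff (E a x) 0 + coeff (E a x) 1 ≈
    a * (a * (a * (4 · 1# * a + 27 · 1#)))
  E-coefficients a x = solve 2 (λ a x →
    # 4 :* a :* (a :* (a :* (a :- x))) :+ a :* (a :* (a :* (# 27 :+ # 4 :* x))) :=
    a :* (a :* (a :* (# 4 :* a :+ # 27)))) refl a x

  module Parameter (a u : Carrier) where
    private
      p q d : Carrier
      p = eval (P a) u
      q = eval (Q a) u
      d = eval (D a) u

      F G T U : Carrier → Carrier
      F = trinomial a a
      G = trinomial p q
      T = transform a u
      U = untransform a u

    -- This and the next three are congruences modulo `F θ` or `G η`. The cofactor is existential
    -- because it is only ever multiplied by zero.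
    G∘T : ∀ θ → ∃[ k ] G (T θ) ≈ k * F θ
    G∘T θ = _ , solve 3 (λ a u θ →
      :trinomial (:P a u) (:Q a u) (:transform a u θ) :=
      :C₁ a u θ :* :trinomial a a θ) refl a u θ

    U∘T : ∀ θ → ∃[ k ] U (T θ) ≈ d * θ + k * F θ
    U∘T θ = _ , solve 3 (λ a u θ →
      :untransform a u (:transform a u θ) :=
      :D a u :* θ :+ :C₂ a u θ :* :trinomial a a θ) refl a u θ

    -- The left side is d³ F(U η / d) with denominators cleared, since `d` is not yet a unit. In the
    -- same way `T∘U` concerns d² T(U η / d).
    F∘U : ∀ η → ∃[ k ] U η * (U η * U η) + a * (d * d) * U η + a * (d * (d * d)) ≈ k * G η
    F∘U η = _ , solve 3 (λ a u η →
      let U = :untransform a u η ; d = :D a u in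
      U :* (U :* U) :+ a :* (d :* d) :* U :+ a :* (d :* (d :* d)) :=
      :C₅ a u η :* :trinomial (:P a u) (:Q a u) η) refl a u η

    T∘U : ∀ η → ∃[ k ] d * U η + u * (3 · 1# * (U η * U η) + 2 · 1# * (a * (d * d))) ≈ d * d * η + k * G η
    T∘U η = _ , solve 3 (λ a u η →
      let U = :untransform a u η ; d = :D a u in
      d :* U :+ u :* (# 3 :* (U :* U) :+ # 2 :* (a :* (d :* d))) :=
      d :* d :* η :+ # 3 :* u :* :C₃ a u η :* :trinomial (:P a u) (:Q a u) η) refl a u η

    -- Here `j` is 1/d, `r` is p/q and `s` is q/p; then `φ` and `ψ` are inverse bijections between
    -- the roots of the two cubics.
    module Normalised {j r s : Carrier} (jd≈1 : j * d ≈ 1#) (rs≈1 : r * s ≈ 1#) (rq≈p : r * q ≈ p) where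
      private
        b : Carrier
        b = p * (r * r)

        φ ψ : Carrier → Carrier
        φ θ = r * T θ
        ψ y = j * U (s * y)

        -- The solver knows no hypotheses. An equation such as `jd≈1` therefore enters as an
        -- explicit multiple of 1 - jd, which is discarded here.
        modulo : ∀ {x y z k} → z ≈ 0# → x ≈ y + k * z → x ≈ y
        modulo z≈0 x≈y+kz = trans x≈y+kz
          (trans (+-congˡ (trans (*-congˡ z≈0) (zeroʳ _))) (+-identityʳ _))

        multiple : ∀ {x z k} → z ≈ 0# → x ≈ k * z → x ≈ 0#
        multiple z≈0 x≈kz = trans x≈kz (trans (*-congˡ z≈0) (zeroʳ _))

        difference : ∀ {x y} → x ≈ y → y - x ≈ 0#
        difference x≈y = trans (+-congˡ (-‿cong x≈y)) (-‿inverseʳ _)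

        cancel : ∀ {x} → r * x ≈ 0# → x ≈ 0#
        cancel {x} rx≈0 = begin
          x             ≈⟨ *-identityˡ x ⟨
          1# * x        ≈⟨ *-congʳ (trans (*-comm s r) rs≈1) ⟨
          s * r * x     ≈⟨ *-assoc s r x ⟩
          s * (r * x)   ≈⟨ multiple rx≈0 refl ⟩
          0#            ∎

        r[sx]≈x : ∀ x → r * (s * x) ≈ x
        r[sx]≈x x = trans (sym (*-assoc r s x)) (trans (*-congʳ rs≈1) (*-identityˡ x))

        s[rx]≈x : ∀ x → s * (r * x) ≈ x
        s[rx]≈x x =
          trans (sym (*-assoc s r x)) (trans (*-congʳ (trans (*-comm s r) rs≈1)) (*-identityˡ x))

        trinomial-cong : ∀ {x y} → x ≈ y → trinomial b b x ≈ trinomial b b y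
        trinomial-cong x≈y =
          +-congʳ (+-cong (*-cong x≈y (*-cong x≈y x≈y)) (*-congˡ x≈y))

        U-cong : ∀ {x y} → x ≈ y → U x ≈ U y
        U-cong x≈y =
          +-congʳ (+-cong (*-congˡ x≈y) (-‿cong (*-congˡ (*-congˡ (*-cong x≈y x≈y)))))

        -- Scaling roots by `r` turns the coefficients p and q into r²p and r³q, and rq = p makes
        -- both equal to `b`.
        scale : ∀ η → trinomial b b (r * η) ≈ r * (r * (r * G η))
        scale η = modulo (difference rq≈p) (solve 4 (λ p q r η →
          :trinomial (p :* (r :* r)) (p :* (r :* r)) (r :* η) :=
          r :* (r :* (r :* :trinomial p q η)) :+ r :* r :* (p :- r :* q)) refl p q r η)

      transform-root : ∀ {θ} → F θ ≈ 0# → trinomial b b (φ θ) ≈ 0#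
      transform-root {θ} Fθ≈0 = trans (scale (T θ))
        (multiple (multiple (multiple (multiple Fθ≈0 (G∘T θ .proj₂)) refl) refl) refl)

      untransform-transform : ∀ {θ} → F θ ≈ 0# → ψ (φ θ) ≈ θ
      untransform-transform {θ} Fθ≈0 = begin
        j * U (s * (r * T θ))  ≈⟨ *-congˡ (U-cong (s[rx]≈x (T θ))) ⟩
        j * U (T θ)            ≈⟨ *-congˡ (modulo Fθ≈0 (U∘T θ .proj₂)) ⟩
        j * (d * θ)            ≈⟨ *-assoc j d θ ⟨
        j * d * θ              ≈⟨ *-congʳ jd≈1 ⟩
        1# * θ                 ≈⟨ *-identityˡ θ ⟩
        θ                      ∎

      private
        G[sy]≈0 : ∀ {y} → trinomial b b y ≈ 0# → G (s * y) ≈ 0#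
        G[sy]≈0 {y} root = cancel (cancel (cancel (begin
          r * (r * (r * G (s * y)))     ≈⟨ scale (s * y) ⟨
          trinomial b b (r * (s * y))   ≈⟨ trinomial-cong (r[sx]≈x y) ⟩
          trinomial b b y               ≈⟨ root ⟩
          0#                            ∎)))

      untransform-root : ∀ {y} → trinomial b b y ≈ 0# → F (ψ y) ≈ 0#
      untransform-root {y} root = trans
        -- The error terms are multiples of 1 - (jd)² and 1 - (jd)³, both divisible by 1 - jd.
        (modulo (difference jd≈1) (solve 4 (λ a j d x →
          :trinomial a a (j :* x) :=
          j :* (j :* (j :* (x :* (x :* x) :+ a :* (d :* d) :* x :+ a :* (d :* (d :* d)))))
            :+ (a :* (j :* x) :* (:1 :+ j :* d) :+
                a :* (:1 :+ j :* d :+ (j :* d) :* (j :* d))) :* (:1 :- j :* d))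
          refl a j d (U (s * y))))
        (multiple (multiple (multiple
          (multiple (G[sy]≈0 root) (F∘U (s * y) .proj₂)) refl) refl) refl)

      transform-untransform : ∀ {y} → trinomial b b y ≈ 0# → φ (ψ y) ≈ y
      transform-untransform {y} root = begin
        r * T (j * U (s * y))  ≈⟨ *-congˡ (modulo (difference jd≈1) (solve 5 (λ a u j d x →
                                    :transform a u (j :* x) :=
                                    j :* j :* (d :* x :+ u :* (# 3 :* (x :* x) :+ # 2 :* (a :* (d :* d))))
                                      :+ (j :* x :+ # 2 :* (a :* u) :* (:1 :+ j :* d)) :* (:1 :- j :* d))
                                    refl a u j d (U (s * y)))) ⟩
        r * (j * j * (d * U (s * y) + u * (3 · 1# * (U (s * y) * U (s * y)) + 2 · 1# * (a * (d * d)))))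
                               ≈⟨ *-congˡ (*-congˡ (modulo (G[sy]≈0 root) (T∘U (s * y) .proj₂))) ⟩
        r * (j * j * (d * d * (s * y)))
                               ≈⟨ *-congˡ (modulo (difference jd≈1) (solve 3 (λ j d x →
                                    j :* j :* (d :* d :* x) :=
                                    x :+ (:- x :* (:1 :+ j :* d)) :* (:1 :- j :* d))
                                    refl j d (s * y))) ⟩
        r * (s * y)            ≈⟨ r[sx]≈x y ⟩
        y                      ∎

-- Coefficients and commutativity of polynomial products.

module PolynomialProduct {c ℓ} (R : RawRing c ℓ)
  (+-isCommutativeMonoid : IsCommutativeMonoid (RawRing._≈_ R) (RawRing._+_ R) (RawRing.0# R))
  (*-comm : Commutative (RawRing._≈_ R) (RawRing._*_ R))
  -- The assumed laws are proved again for polynomials below, so the module applies first to `K` and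
  -- then to K[T].
  (zeroˡ : ∀ x y → RawRing._≈_ R x (RawRing.0# R) →
           RawRing._≈_ R (RawRing._*_ R x y) (RawRing.0# R))
  where

  open RawRing R
  open Polynomial R
  open IsCommutativeMonoid +-isCommutativeMonoid
    renaming ( ∙-cong to +-cong; ∙-congˡ to +-congˡ; ∙-congʳ to +-congʳ; identityˡ to +-identityˡ
             ; identityʳ to +-identityʳ; assoc to +-assoc; comm to +-comm )

  private
    zeroʳ : ∀ x → x * 0# ≈ 0#
    zeroʳ x = trans (*-comm x 0#) (zeroˡ 0# x refl)

  coeff-+ : ∀ p q n → coeff (p +ᴾ q) n ≈ coeff p n + coeff q n
  coeff-+ []      q       n       = sym (+-identityˡ _)
  coeff-+ (a ∷ p) []      n       = sym (+-identityʳ _)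
  coeff-+ (a ∷ p) (b ∷ q) zero    = refl
  coeff-+ (a ∷ p) (b ∷ q) (suc n) = coeff-+ p q n

  coeff-scale : ∀ a p n → coeff (map (a *_) p) n ≈ a * coeff p n
  coeff-scale a []      n       = sym (zeroʳ a)
  coeff-scale a (b ∷ p) zero    = refl
  coeff-scale a (b ∷ p) (suc n) = coeff-scale a p n

  coeff-*-zero : ∀ p q → coeff (p *ᴾ q) 0 ≈ coeff p 0 * coeff q 0
  coeff-*-zero []      q = sym (zeroˡ _ _ refl)
  coeff-*-zero (a ∷ p) q = begin
    coeff (map (a *_) q +ᴾ (0# ∷ p *ᴾ q)) 0  ≈⟨ coeff-+ (map (a *_) q) _ 0 ⟩
    coeff (map (a *_) q) 0 + 0#              ≈⟨ +-identityʳ _ ⟩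
    coeff (map (a *_) q) 0                   ≈⟨ coeff-scale a q 0 ⟩
    a * coeff q 0                            ∎
    where open ≈-Reasoning setoid

  coeff-*-suc : ∀ a p q n →
    coeff ((a ∷ p) *ᴾ q) (suc n) ≈ a * coeff q (suc n) + coeff (p *ᴾ q) n
  coeff-*-suc a p q n =
    trans (coeff-+ (map (a *_) q) _ (suc n)) (+-congʳ (coeff-scale a q (suc n)))

  coeff-*-one : ∀ p q → coeff (p *ᴾ q) 1 ≈ coeff p 0 * coeff q 1 + coeff p 1 * coeff q 0
  coeff-*-one []      q = sym (trans (+-cong (zeroˡ _ _ refl) (zeroˡ _ _ refl)) (+-identityˡ 0#))
  coeff-*-one (a ∷ p) q = trans (coeff-*-suc a p q 0) (+-congˡ (coeff-*-zero p q))

  +ᴾ-isCommutativeMonoid : IsCommutativeMonoid _≈ᴾ_ _+ᴾ_ []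
  +ᴾ-isCommutativeMonoid = record
    { isMonoid = record
      { isSemigroup = record
        { isMagma = record
          { isEquivalence = record
            { refl  = λ n → refl
            ; sym   = λ p≈q n → sym (p≈q n)
            ; trans = λ p≈q q≈r n → trans (p≈q n) (q≈r n)
            }
          ; ∙-cong = λ {p} {p′} {q} {q′} p≈p′ q≈q′ n →
              trans (coeff-+ p q n) (trans (+-cong (p≈p′ n) (q≈q′ n)) (sym (coeff-+ p′ q′ n)))
          }
        ; assoc = λ p q r n → let open ≈-Reasoning setoid in begin
            coeff (p +ᴾ q +ᴾ r) n                ≈⟨ coeff-+ (p +ᴾ q) r n ⟩
            coeff (p +ᴾ q) n + coeff r n         ≈⟨ +-congʳ (coeff-+ p q n) ⟩
            coeff p n + coeff q n + coeff r n    ≈⟨ +-assoc _ _ _ ⟩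
            coeff p n + (coeff q n + coeff r n)  ≈⟨ +-congˡ (coeff-+ q r n) ⟨
            coeff p n + coeff (q +ᴾ r) n         ≈⟨ coeff-+ p (q +ᴾ r) n ⟨
            coeff (p +ᴾ (q +ᴾ r)) n              ∎
        }
      ; identity = (λ p n → refl) , (λ p n → trans (coeff-+ p [] n) (+-identityʳ _))
      }
    ; comm = λ p q n →
        trans (coeff-+ p q n) (trans (+-comm _ _) (sym (coeff-+ q p n)))
    }

  private
    +ᴾ-commutativeMonoid : CommutativeMonoid c ℓ
    +ᴾ-commutativeMonoid = record { isCommutativeMonoid = +ᴾ-isCommutativeMonoid }

    module +ᴾ = CommutativeMonoid +ᴾ-commutativeMonoid

  open import Algebra.Properties.CommutativeSemigroup +ᴾ.commutativeSemigroup using (x∙yz≈y∙xz)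

  ∷-cong : ∀ {a b p q} → a ≈ b → p ≈ᴾ q → (a ∷ p) ≈ᴾ (b ∷ q)
  ∷-cong a≈b p≈q zero    = a≈b
  ∷-cong a≈b p≈q (suc n) = p≈q n

  *ᴾ-zeroʳ : ∀ p → p *ᴾ [] ≈ᴾ []
  *ᴾ-zeroʳ []      n       = refl
  *ᴾ-zeroʳ (a ∷ p) zero    = refl
  *ᴾ-zeroʳ (a ∷ p) (suc n) = *ᴾ-zeroʳ p n

  *ᴾ-zeroˡ : ∀ p q → p ≈ᴾ [] → p *ᴾ q ≈ᴾ []
  *ᴾ-zeroˡ []      q p≈[] n       = refl
  *ᴾ-zeroˡ (a ∷ p) q p≈[] zero    = trans (coeff-*-zero (a ∷ p) q) (zeroˡ _ _ (p≈[] 0))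
  *ᴾ-zeroˡ (a ∷ p) q p≈[] (suc n) = trans (coeff-*-suc a p q n)
    (trans (+-cong (zeroˡ _ _ (p≈[] 0)) (*ᴾ-zeroˡ p q (p≈[] ∘ suc) n)) (+-identityˡ 0#))

  -- The mirror image of the defining recursion, which runs on the left factor; the two together
  -- give commutativity.
  *ᴾ-∷ : ∀ p b q → p *ᴾ (b ∷ q) ≈ᴾ map (b *_) p +ᴾ (0# ∷ p *ᴾ q)
  *ᴾ-∷ []      b q = λ { zero → refl ; (suc n) → refl }
  *ᴾ-∷ (a ∷ p) b q = ∷-cong (+-congʳ (*-comm a b)) (begin
    map (a *_) q +ᴾ p *ᴾ (b ∷ q)
      ≈⟨ +ᴾ.∙-congˡ {map (a *_) q} {p *ᴾ (b ∷ q)} (*ᴾ-∷ p b q) ⟩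
    map (a *_) q +ᴾ (map (b *_) p +ᴾ (0# ∷ p *ᴾ q))
      ≈⟨ x∙yz≈y∙xz (map (a *_) q) (map (b *_) p) (0# ∷ p *ᴾ q) ⟩
    map (b *_) p +ᴾ (map (a *_) q +ᴾ (0# ∷ p *ᴾ q))
      ∎)
    where open ≈-Reasoning +ᴾ.setoid

  *ᴾ-comm : Commutative _≈ᴾ_ _*ᴾ_
  *ᴾ-comm []      q = +ᴾ.sym {q *ᴾ []} {[]} (*ᴾ-zeroʳ q)
  *ᴾ-comm (a ∷ p) q = begin
    map (a *_) q +ᴾ (0# ∷ p *ᴾ q)
      ≈⟨ +ᴾ.∙-congˡ {map (a *_) q} {0# ∷ p *ᴾ q} (∷-cong refl (*ᴾ-comm p q)) ⟩
    map (a *_) q +ᴾ (0# ∷ q *ᴾ p)  ≈⟨ *ᴾ-∷ q a p ⟨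
    q *ᴾ (a ∷ p)                   ∎
    where open ≈-Reasoning +ᴾ.setoid

  X : Poly
  X = 0# ∷ 1# ∷ []

  -- With zero constant term `g` is X times its tail; cancelling X from both sides leaves the tail
  -- as an inverse of `h`.
  cofactor-∣1 : ∀ g h → g *ᴾ h ≈ᴾ X → coeff g 0 ≈ 0# → ∃[ k ] k *ᴾ h ≈ᴾ (1# ∷ [])
  cofactor-∣1 []      h gh≈X g₀≈0 = [] , gh≈X ∘ suc
  cofactor-∣1 (a ∷ g) h gh≈X a≈0  = g , λ n → begin
    coeff (g *ᴾ h) n                            ≈⟨ +-identityˡ _ ⟨
    0# + coeff (g *ᴾ h) n                       ≈⟨ +-congʳ (zeroˡ _ _ a≈0) ⟨
    a * coeff h (suc n) + coeff (g *ᴾ h) n      ≈⟨ coeff-*-suc a g h n ⟨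
    coeff ((a ∷ g) *ᴾ h) (suc n)                ≈⟨ gh≈X (suc n) ⟩
    coeff (1# ∷ []) n                           ∎
    where open ≈-Reasoning setoid

-- Apartness and invertibility in a Heyting field.

module HeytingFieldProperties {c ℓ₁ ℓ₂} (K : HeytingField c ℓ₁ ℓ₂) where
  open HeytingField K public
  open HeytingCommutativeRing heytingCommutativeRing public using (commutativeRing)
  open import Algebra.Apartness.Properties.HeytingCommutativeRing heytingCommutativeRing public
  open import Algebra.Properties.AbelianGroup (CommutativeRing.+-abelianGroup commutativeRing) using (xyx⁻¹≈y)

  -- The field axiom inverts differences of apart elements, here `x - 0#`.
  inverse : ∀ {x} → x # 0# → ∃[ x⁻¹ ] x⁻¹ * x ≈ 1#
  inverse x#0 with x⁻¹ , x⁻¹x≈1 , _ ← #⇒invertible x#0 =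
    x⁻¹ , trans (*-congˡ (sym (x-0≈x _))) x⁻¹x≈1

  unit⇒#0 : ∀ {x y} → y * x ≈ 1# → x # 0#
  unit⇒#0 yx≈1 = invertibleˡ⇒# (_ , trans (*-congˡ (x-0≈x _)) yx≈1)

  x#y⇒x-y#0 : ∀ {x y} → x # y → x - y # 0#
  x#y⇒x-y#0 x#y with _ , yx≈1 , _ ← #⇒invertible x#y = unit⇒#0 yx≈1

  x-y#0⇒x#y : ∀ {x y} → x - y # 0# → x # y
  x-y#0⇒x#y x-y#0 = invertibleˡ⇒# (inverse x-y#0)

  xy#0⇒y#0 : ∀ {x y} → x * y # 0# → y # 0#
  xy#0⇒y#0 xy#0 with z , z[xy]≈1 ← inverse xy#0 = unit⇒#0 (trans (*-assoc z _ _) z[xy]≈1)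

  xy#0⇒x#0 : ∀ {x y} → x * y # 0# → x # 0#
  xy#0⇒x#0 xy#0 = xy#0⇒y#0 (#-congʳ (*-comm _ _) xy#0)

  -- Cotransitivity at `x` makes the choice, in place of deciding whether an element is zero.
  x+y#0⇒x#0∨y#0 : ∀ {x y} → x + y # 0# → x # 0# ⊎ y # 0#
  x+y#0⇒x#0∨y#0 {x} {y} x+y#0 with #-cotrans x+y#0 x
  ... | inj₁ x+y#x = inj₂ (#-congʳ (xyx⁻¹≈y x y) (x#y⇒x-y#0 x+y#x))
  ... | inj₂ x#0   = inj₁ x#0

  xy≈0∧y#0⇒x≈0 : ∀ {x y} → x * y ≈ 0# → y # 0# → x ≈ 0#
  xy≈0∧y#0⇒x≈0 {x} {y} xy≈0 y#0 with z , zy≈1 ← inverse y#0 = begin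
    x            ≈⟨ *-identityʳ x ⟨
    x * 1#       ≈⟨ *-congˡ (trans (*-comm y z) zy≈1) ⟨
    x * (y * z)  ≈⟨ *-assoc x y z ⟨
    x * y * z    ≈⟨ *-congʳ xy≈0 ⟩
    0# * z       ≈⟨ zeroˡ z ⟩
    0#           ∎
    where open ≈-Reasoning setoid

-- Irreducibility of X and infinitude of Hilbertian fields.

module Infinite {c ℓ₁ ℓ₂} (K : HeytingField c ℓ₁ ℓ₂) where
  open HeytingFieldProperties K
  open Polynomial (rawRing K) using (Poly; coeff; eval; _+ᴾ_; _*ᴾ_; _≈ᴾ_; polyRing)

  private
    module X = Polynomial polyRing
    module K[T] = PolynomialProduct (rawRing K) +-isCommutativeMonoid *-comm
      (λ x y x≈0 → trans (*-congʳ x≈0) (zeroˡ y))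
    module K[T][X] = PolynomialProduct polyRing K[T].+ᴾ-isCommutativeMonoid K[T].*ᴾ-comm
      K[T].*ᴾ-zeroˡ

  -- Coefficients of `p` vanish from the bottom up: `a` times a unit is the constant term of the
  -- product, and once `a` is 0 a factor X can be removed.
  regular : ∀ p q → p *ᴾ q ≈ᴾ [] → coeff q 0 # 0# → p ≈ᴾ []
  regular []      q pq≈0 q₀#0 n       = refl
  regular (a ∷ p) q pq≈0 q₀#0 = λ { zero → a≈0 ; (suc n) → regular p q pq≈0′ q₀#0 n }
    where
    a≈0 : a ≈ 0#
    a≈0 = xy≈0∧y#0⇒x≈0 (trans (sym (K[T].coeff-*-zero (a ∷ p) q)) (pq≈0 0)) q₀#0

    pq≈0′ : p *ᴾ q ≈ᴾ []
    pq≈0′ n = begin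
      coeff (p *ᴾ q) n                        ≈⟨ +-identityˡ _ ⟨
      0# + coeff (p *ᴾ q) n                   ≈⟨ +-congʳ (trans (*-congʳ a≈0) (zeroˡ _)) ⟨
      a * coeff q (suc n) + coeff (p *ᴾ q) n  ≈⟨ K[T].coeff-*-suc a p q n ⟨
      coeff ((a ∷ p) *ᴾ q) (suc n)            ≈⟨ pq≈0 (suc n) ⟩
      0#                                      ∎
      where open ≈-Reasoning setoid

  X : X.Poly
  X = K[T][X].X

  -- If g h = X then g₀ h₀ = 0 and g₀ h₁ + g₁ h₀ = 1 in K[T].  Comparing constant
  -- terms in the latter shows that g₀ or h₀ is regular, so the other one is 0.
  X-irreducible : Irreducible X.polyRing X
  X-irreducible = mkIrred
    -- X is not a unit: its multiples have constant term 0.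
    (λ { record { quotient = q ; equality = qX≈1 } → #-irrefl
      (trans (sym (qX≈1 0 0)) (trans (K[T][X].coeff-*-zero q X 0) (K[T].*ᴾ-zeroʳ (X.coeff q 0) 0)))
      1#0 })
    (λ {g} {h} → split g h)
    where
    _∣1 : X.Poly → Set _
    g ∣1 = RawMagmaDefinitions._∣_ (RawRing.*-rawMagma X.polyRing) g (RawRing.1# X.polyRing)

    cofactor : ∀ g h → g X.*ᴾ h X.≈ᴾ X → X.coeff g 0 *ᴾ X.coeff h 0 ≈ᴾ [] →
               coeff (X.coeff h 0) 0 # 0# → h ∣1
    cofactor g h gh≈X g₀h₀≈0 h₀₀#0
      with k , kh≈1 ← K[T][X].cofactor-∣1 g h gh≈X (regular (X.coeff g 0) (X.coeff h 0) g₀h₀≈0 h₀₀#0)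
      = record { quotient = k ; equality = kh≈1 }

    split : ∀ g h → X X.≈ᴾ g X.*ᴾ h → g ∣1 ⊎ h ∣1
    split g h X≈gh = Sum.map (g-unit ∘ xy#0⇒x#0) (h-unit ∘ xy#0⇒y#0)
      (x+y#0⇒x#0∨y#0 (#-congʳ linear-term 1#0))
      where
      g₀ g₁ h₀ h₁ : List Carrier
      g₀ = X.coeff g 0
      g₁ = X.coeff g 1
      h₀ = X.coeff h 0
      h₁ = X.coeff h 1

      gh≈X : g X.*ᴾ h X.≈ᴾ X
      gh≈X m n = sym (X≈gh m n)

      hg≈X : h X.*ᴾ g X.≈ᴾ X
      hg≈X m n = trans (K[T][X].*ᴾ-comm h g m n) (gh≈X m n)

      g₀h₀≈0 : g₀ *ᴾ h₀ ≈ᴾ []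
      g₀h₀≈0 n = trans (sym (K[T][X].coeff-*-zero g h n)) (gh≈X 0 n)

      linear-term : 1# ≈ coeff g₀ 0 * coeff h₁ 0 + coeff g₁ 0 * coeff h₀ 0
      linear-term = begin
        1#                                         ≈⟨ gh≈X 1 0 ⟨
        coeff (X.coeff (g X.*ᴾ h) 1) 0             ≈⟨ K[T][X].coeff-*-one g h 0 ⟩
        coeff (g₀ *ᴾ h₁ +ᴾ g₁ *ᴾ h₀) 0             ≈⟨ K[T].coeff-+ (g₀ *ᴾ h₁) (g₁ *ᴾ h₀) 0 ⟩
        coeff (g₀ *ᴾ h₁) 0 + coeff (g₁ *ᴾ h₀) 0    ≈⟨ +-cong (K[T].coeff-*-zero g₀ h₁)
                                                             (K[T].coeff-*-zero g₁ h₀) ⟩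
        coeff g₀ 0 * coeff h₁ 0 + coeff g₁ 0 * coeff h₀ 0  ∎
        where open ≈-Reasoning setoid

      h-unit : coeff h₀ 0 # 0# → h ∣1
      h-unit = cofactor g h gh≈X g₀h₀≈0

      g-unit : coeff g₀ 0 # 0# → g ∣1
      g-unit = cofactor h g hg≈X (λ n → trans (K[T].*ᴾ-comm h₀ g₀ n) (g₀h₀≈0 n))

  -- The derivative of X is 1, so the Bézout identity holds with cofactors 0 and 1 and denominator
  -- 1.
  X-separable : SeparableInX K X
  X-separable = [] , RawRing.1# X.polyRing , (1# ∷ []) , (0 , 1#0) , λ where
    zero    zero          → trans (+-identityʳ _) (*-identityʳ 1#)
    zero    (suc n)       → refl
    (suc zero) zero       → refl
    (suc zero) (suc n)    → refl
    (suc (suc m)) n       → refl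

  hilbertian⇒infinite : Hilbertian K → InfinitelyMany K (λ _ → ⊤)
  hilbertian⇒infinite hilbertian xs
    with t , _ , t#xs ← hilbertian X X-irreducible (0 , 0 , 1#0) X-separable xs = t , _ , t#xs

  -- Division by X - s and nonroots of nonzero polynomials.

  open IntegerCoefficients commutativeRing using (solve; _:=_; con; _:+_; _:*_; _:-_; :-_)

  -- The quotient of X p by X − s.
  quotient : Carrier → Poly → Poly
  quotient s []      = []
  quotient s (a ∷ p) = eval (a ∷ p) s ∷ quotient s p

  length-quotient : ∀ s p → length (quotient s p) ≡ length p
  length-quotient s []      = ≡.refl
  length-quotient s (a ∷ p) = ≡.cong suc (length-quotient s p)

  -- Horner's scheme. Dividing X p instead of p lets the induction follow the recursion of `eval`.
  eval-quotient : ∀ x s p → x * eval p x ≈ s * eval p s + (x - s) * eval (quotient s p) x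
  eval-quotient x s []      = solve 2 (λ x s →
    x :* con (+ 0) := s :* con (+ 0) :+ (x :- s) :* con (+ 0)) refl x s
  eval-quotient x s (a ∷ p) = begin
    x * (a + x * eval p x)
      ≈⟨ *-congˡ (+-congˡ (eval-quotient x s p)) ⟩
    x * (a + (s * eval p s + (x - s) * eval (quotient s p) x))
      ≈⟨ solve 5 (λ x s a y z →
           x :* (a :+ (s :* y :+ (x :- s) :* z)) :=
           s :* (a :+ s :* y) :+ (x :- s) :* (a :+ s :* y :+ x :* z))
           refl x s a (eval p s) (eval (quotient s p) x) ⟩
    s * (a + s * eval p s) + (x - s) * (a + s * eval p s + x * eval (quotient s p) x)
      ∎
    where open ≈-Reasoning setoid

  eval-difference : ∀ x s a p →
    (x - s) * eval (quotient s p) x ≈ eval (a ∷ p) x - eval (a ∷ p) s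
  eval-difference x s a p = begin
    (x - s) * eval (quotient s p) x
      ≈⟨ solve 3 (λ a y z → z := a :+ (y :+ z) :- (a :+ y))
           refl a (s * eval p s) ((x - s) * eval (quotient s p) x) ⟩
    a + (s * eval p s + (x - s) * eval (quotient s p) x) - (a + s * eval p s)
      ≈⟨ +-congʳ (+-congˡ (eval-quotient x s p)) ⟨
    eval (a ∷ p) x - eval (a ∷ p) s
      ∎
    where open ≈-Reasoning setoid

  eval#0⇒quotient-nonzero : ∀ s p → eval p s # 0# → NonzeroPoly K (quotient s p)
  eval#0⇒quotient-nonzero s []      0#0  = ⊥-elim (#-irrefl refl 0#0)
  eval#0⇒quotient-nonzero s (a ∷ p) ps#0 = 0 , ps#0

  constant#0⇒eval#0 : ∀ s a p → a # 0# → eval (a ∷ p) s # 0# ⊎ eval p s # 0#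
  constant#0⇒eval#0 s a p a#0 = Sum.map₂ xy#0⇒y#0 (x+y#0⇒x#0∨y#0 (#-congʳ
    (solve 3 (λ a s y → a := a :+ s :* y :+ (:- s) :* y) refl a s (eval p s)) a#0))

  -- The coefficients of the quotient are the values at `s` of the successive tails of `p`. Each
  -- coefficient of `p` is one such value minus `s` times the next, so one of these two is apart
  -- from 0.
  quotient-nonzero : ∀ s p → NonzeroPoly K p → NonzeroPoly K (quotient s p)
  quotient-nonzero s []      (n     , 0#0)  = ⊥-elim (#-irrefl refl 0#0)
  quotient-nonzero s (a ∷ p) (zero  , a#0)  with constant#0⇒eval#0 s a p a#0
  ... | inj₁ e#0 = 0 , e#0
  ... | inj₂ e#0 with n , c#0 ← eval#0⇒quotient-nonzero s p e#0 = suc n , c#0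
  quotient-nonzero s (a ∷ p) (suc n , pₙ#0) with m , c#0 ← quotient-nonzero s p (n , pₙ#0) =
    suc m , c#0

  -- Given s in S, either p(s) # 0 or there is a t in S with t # s at which the
  -- quotient of p − p(s) by X − s is nonzero, and then p(t) # p(s).
  infinite-nonroots : ∀ {ℓ} {S : Pred Carrier ℓ} p → NonzeroPoly K p →
    InfinitelyMany K S → InfinitelyMany K (λ x → S x × eval p x # 0#)
  infinite-nonroots {S = S} p p≉0 S-infinite = go (length p) p ≡.refl p≉0
    where
    -- The recursion is on the length because the quotient is not a subterm of `p`.
    go : ∀ n p → length p ≡ n → NonzeroPoly K p →
         InfinitelyMany K (λ x → S x × eval p x # 0#)
    go n       []      _   (_ , 0#0) = ⊥-elim (#-irrefl refl 0#0)
    go (suc n) (a ∷ p) len p≉0       xs with s , s∈S , s#xs ← S-infinite xs =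
      [ (λ ps#0 → s , (s∈S , ps#0) , s#xs) , (λ q≉0 → helper (go n (quotient s p)
        (≡.trans (length-quotient s p) (≡.cong ℕ.pred len)) q≉0 (s ∷ xs))) ]′ (nonzero p≉0)
      where
      nonzero : NonzeroPoly K (a ∷ p) → eval (a ∷ p) s # 0# ⊎ NonzeroPoly K (quotient s p)
      nonzero (zero  , a#0)  = Sum.map₂ (eval#0⇒quotient-nonzero s p) (constant#0⇒eval#0 s a p a#0)
      nonzero (suc m , pₘ#0) = inj₂ (quotient-nonzero s p (m , pₘ#0))

      helper : ∃[ t ] (S t × eval (quotient s p) t # 0#) × All (t #_) (s ∷ xs) →
               ∃[ t ] (S t × eval (a ∷ p) t # 0#) × All (t #_) xs
      helper (t , (t∈S , qt#0) , t#s ∷ t#xs) =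
        -- Two values apart from each other cannot both be 0: either `t` is a nonroot, or `s` was
        -- one already.
        [ (λ pt#0 → t , (t∈S , pt#0) , t#xs) , (λ 0#ps → s , (s∈S , #-sym 0#ps) , s#xs) ]′
        (#-cotrans pt#ps 0#)
        where
        pt#ps : eval (a ∷ p) t # eval (a ∷ p) s
        pt#ps = x-y#0⇒x#y (#-congʳ (eval-difference t s a p)
          (x#0y#0→xy#0 (x#y⇒x-y#0 t#s) qt#0))

  -- Each polynomial in turn cuts `S` down to a set that is still infinite.
  infinite-common-nonroots : ∀ {a ℓ} {A : Set a} {S : Pred Carrier ℓ} (f : A → Poly) →
    (∀ x → NonzeroPoly K (f x)) → ∀ xs → InfinitelyMany K S →
    InfinitelyMany K (λ t → S t × All (λ x → eval (f x) t # 0#) xs)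
  infinite-common-nonroots f f≉0 []       S-infinite ys
    with t , t∈S , t#ys ← S-infinite ys = t , (t∈S , []) , t#ys
  infinite-common-nonroots f f≉0 (x ∷ xs) S-infinite ys
    with t , ((t∈S , ft#0) , fst#0) , t#ys ←
      infinite-common-nonroots f f≉0 xs (infinite-nonroots (f x) (f≉0 x) S-infinite) ys =
    t , (t∈S , ft#0 ∷ fst#0) , t#ys

-- Transport to the algebraic closure and equality of splitting fields.

module SplittingField {c ℓ₁ ℓ₂ c′ ℓ₁′ ℓ₂′} {M : HeytingField c ℓ₁ ℓ₂}
  (closure : AlgebraicClosure M c′ ℓ₁′ ℓ₂′) where

  open AlgebraicClosure closure using (Ω; ι; ι-isMonomorphism; IsRootOf)
  open HeytingFieldProperties Ω
  open IsRingMonomorphism ι-isMonomorphism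
    using (+-homo; *-homo; -‿homo; 0#-homo; 1#-homo) renaming (⟦⟧-cong to ι-cong)
  open IntegerCoefficients commutativeRing using (solve; _:=_; con; _:+_; _:*_; _:^_)

  private
    module M = HeytingFieldProperties M
    module M[X] = Polynomial (rawRing M)
    module Ω[X] = Polynomial (rawRing Ω)
    module MT = Tschirnhaus M.commutativeRing
    module ΩT = Tschirnhaus commutativeRing

  infix 4 _↦_
  -- As a relation, images under `ι` are computed by combinators that follow the shape of the term.
  _↦_ : M.Carrier → Carrier → Set ℓ₁′
  x ↦ y = ι x ≈ y

  infixl 6 _↦+_
  infixl 7 _↦*_

  _↦+_ : ∀ {x y x′ y′} → x ↦ x′ → y ↦ y′ → x M.+ y ↦ x′ + y′
  f ↦+ g = trans (+-homo _ _) (+-cong f g)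

  _↦*_ : ∀ {x y x′ y′} → x ↦ x′ → y ↦ y′ → x M.* y ↦ x′ * y′
  f ↦* g = trans (*-homo _ _) (*-cong f g)

  ↦- : ∀ {x x′} → x ↦ x′ → M.- x ↦ - x′
  ↦- f = trans (-‿homo _) (-‿cong f)

  ↦numeral : ∀ n → numeral M n ↦ numeral Ω n
  ↦numeral zero    = 0#-homo
  ↦numeral (suc n) = 1#-homo ↦+ ↦numeral n

  ↦eval : ∀ {p q} x → Pointwise _↦_ p q → M[X].eval p x ↦ Ω[X].eval q (ι x)
  ↦eval x []           = 0#-homo
  ↦eval x (a↦b ∷ p↦q)  = a↦b ↦+ refl ↦* ↦eval x p↦q

  ↦P : ∀ a → Pointwise _↦_ (MT.P a) (ΩT.P (ι a))
  ↦P a = refl ∷ ↦numeral 9 ↦* refl ∷ ↦- (↦numeral 3 ↦* (refl ↦* refl)) ∷ []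

  ↦Q : ∀ a → Pointwise _↦_ (MT.Q a) (ΩT.Q (ι a))
  ↦Q a = refl ∷ ↦- (↦numeral 2 ↦* (refl ↦* refl)) ∷ ↦- (↦numeral 9 ↦* (refl ↦* refl)) ∷
    ↦- (↦numeral 27 ↦* (refl ↦* refl) ↦+ ↦numeral 2 ↦* (refl ↦* (refl ↦* refl))) ∷ []

  ↦D : ∀ a → Pointwise _↦_ (MT.D a) (ΩT.D (ι a))
  ↦D a = 1#-homo ∷ 0#-homo ∷ ↦numeral 9 ↦* refl ∷ ↦numeral 27 ↦* refl ∷ []

  eval-cubic : ∀ {b b′} x → b ↦ b′ →
    Ω[X].eval (map ι (cubic M b)) x ≈ ΩT.trinomial b′ b′ x
  eval-cubic {b} {b′} x b↦b′ = trans
    (+-cong b↦b′ (*-congˡ (+-cong b↦b′ (*-congˡ (+-cong 0#-homo (*-congˡ (+-congʳ 1#-homo)))))))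
    (solve 2 (λ b x →
      -- The zeroth power stands for `1#` itself.
      b :+ x :* (b :+ x :* (con (+ 0) :+ x :* (con (+ 0) :^ 0 :+ x :* con (+ 0)))) :=
      x :* (x :* x) :+ b :* x :+ b) refl b′ x)

  Adjoin-least : ∀ {s t} {S : Pred Carrier s} {T : Pred Carrier t} →
    S ⊆ Adjoin closure T → Adjoin closure S ⊆ Adjoin closure T
  Adjoin-least S⊆ (base m)        = base m
  Adjoin-least S⊆ (gen x∈S)       = S⊆ x∈S
  Adjoin-least S⊆ (add x y)       = add (Adjoin-least S⊆ x) (Adjoin-least S⊆ y)
  Adjoin-least S⊆ (mul x y)       = mul (Adjoin-least S⊆ x) (Adjoin-least S⊆ y)
  Adjoin-least S⊆ (neg x)         = neg (Adjoin-least S⊆ x)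
  Adjoin-least S⊆ (inv xy≈1 x)    = inv xy≈1 (Adjoin-least S⊆ x)
  Adjoin-least S⊆ (respect x≈y x) = respect x≈y (Adjoin-least S⊆ x)

  module _ {s} {S : Pred Carrier s} where
    base-↦ : ∀ {x y} → x ↦ y → Adjoin closure S y
    base-↦ x↦y = respect x↦y (base _)

    transform-∈ : ∀ a u {x} → Adjoin closure S x →
      Adjoin closure S (ΩT.transform (ι a) (ι u) x)
    transform-∈ a u x∈ = add x∈ (mul (base u)
      (add (mul (base-↦ (↦numeral 3)) (mul x∈ x∈)) (mul (base-↦ (↦numeral 2)) (base a))))

    untransform-∈ : ∀ a u {x} → Adjoin closure S x →
      Adjoin closure S (ΩT.untransform (ι a) (ι u) x)
    untransform-∈ a u x∈ = add (add
      (mul (base-↦ (1#-homo ↦+ ↦numeral 3 ↦* (refl ↦* (refl ↦* refl)))) x∈)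
      (neg (mul (base-↦ (↦numeral 3)) (mul (base u) (mul x∈ x∈)))))
      (neg (base-↦ (↦numeral 2 ↦* (refl ↦* ↦eval u (↦P a)))))

  -- Every root of either cubic is a polynomial over `M` in a root of the other, so the generators
  -- of each field lie in the other.
  Spl-transform : ∀ a u {j r s} → let p = M[X].eval (MT.P a) u in
    j M.* M[X].eval (MT.D a) u M.≈ M.1# → r M.* s M.≈ M.1# → r M.* M[X].eval (MT.Q a) u M.≈ p →
    Spl closure (cubic M a) ≐ Spl closure (cubic M (p M.* (r M.* r)))
  Spl-transform a u {j} {r} {s} jd≈1 rs≈1 rq≈p =
      -- θ = ψ(φ θ), where φ θ is a root of the second cubic.
      Adjoin-least (λ {θ} root →
        let Fθ≈0 = trans (sym (eval-cubic θ refl)) root in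
        respect (untransform-transform Fθ≈0)
          (mul (base j) (untransform-∈ a u (mul (base s)
            (gen (trans (eval-cubic _ ↦b) (transform-root Fθ≈0)))))))
    -- Conversely y = φ(ψ y), where ψ y is a root of the first cubic.
    , Adjoin-least (λ {y} root →
        let Gy≈0 = trans (sym (eval-cubic y ↦b)) root in
        respect (transform-untransform Gy≈0)
          (mul (base r) (transform-∈ a u
            (gen (trans (eval-cubic _ refl) (untransform-root Gy≈0))))))
    where
    ↦p : M[X].eval (MT.P a) u ↦ Ω[X].eval (ΩT.P (ι a)) (ι u)
    ↦p = ↦eval u (↦P a)

    ↦b : M[X].eval (MT.P a) u M.* (r M.* r) ↦ Ω[X].eval (ΩT.P (ι a)) (ι u) * (ι r * ι r)
    ↦b = ↦p ↦* (refl ↦* refl)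

    ↦-≈ : ∀ {x y x′ y′} → x ↦ x′ → y ↦ y′ → x M.≈ y → x′ ≈ y′
    ↦-≈ x↦ y↦ x≈y = trans (sym x↦) (trans (ι-cong x≈y) y↦)

    open ΩT.Parameter.Normalised (ι a) (ι u)
      (↦-≈ (refl ↦* ↦eval u (↦D a)) 1#-homo jd≈1)
      (↦-≈ (refl ↦* refl) 1#-homo rs≈1)
      (↦-≈ (refl ↦* ↦eval u (↦Q a)) ↦p rq≈p)

-- Choice of u and construction of b.

corollary4p11 : ∀ {c₀ ℓ₀ ℓ₀′ c ℓ₁ ℓ₂ c′ ℓ₁′ ℓ₂′}
    (k : HeytingField c₀ ℓ₀ ℓ₀′) → ¬ HasCharacteristic k 3 →
    ∀ (M : HeytingField c ℓ₁ ℓ₂)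
    (j : HeytingField.Carrier k → HeytingField.Carrier M) →
    IsRingMonomorphism (rawRing k) (rawRing M) j →
    Hilbertian M →
    ∀ (closure : AlgebraicClosure M c′ ℓ₁′ ℓ₂′) →
    let open HeytingField M in
    ∀ (a : Carrier) → a * (numeral M 4 * a + numeral M 27) # 0# →
    InfinitelyMany M (λ b → Spl closure (cubic M a) ≐ Spl closure (cubic M b))
corollary4p11 _ _ M _ _ hilbertian closure a disc#0 xs = conclude
  -- The constant terms a, a and 1 show that `P a`, `Q a` and `D a` are nonzero. The list `xs` is to
  -- be avoided by b, hence by the values of `E a x`; the list to be avoided by u is the final `[]`.
  (infinite-common-nonroots (E a) E≉0 xs
    (infinite-nonroots (D a) (0 , 1#0)
      (infinite-nonroots (Q a) (0 , a#0)
        (infinite-nonroots (P a) (0 , a#0)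
          (hilbertian⇒infinite hilbertian)))) [])
  where
  open HeytingFieldProperties M
  open Infinite M
  open Tschirnhaus commutativeRing
  open Polynomial (rawRing M) using (eval)

  a#0 : a # 0#
  a#0 = xy#0⇒x#0 disc#0

  E≉0 : ∀ x → NonzeroPoly M (E a x)
  E≉0 x = [ (λ e₀#0 → 0 , xy#0⇒y#0 e₀#0) , (λ e₁#0 → 1 , e₁#0) ]′
    (x+y#0⇒x#0∨y#0 (#-congʳ (sym (E-coefficients a x))
      (x#0y#0→xy#0 a#0 (x#0y#0→xy#0 a#0 disc#0))))

  module _ {u} (p#0 : eval (P a) u # 0#) (q#0 : eval (Q a) u # 0#) (d#0 : eval (D a) u # 0#) where
    p q r b : Carrier
    p = eval (P a) u
    q = eval (Q a) u
    r = p * inverse q#0 .proj₁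
    b = p * (r * r)

    rq≈p : r * q ≈ p
    rq≈p = trans (*-assoc p _ q) (trans (*-congˡ (inverse q#0 .proj₂)) (*-identityʳ p))

    rs≈1 : r * (q * inverse p#0 .proj₁) ≈ 1#
    rs≈1 = trans (sym (*-assoc r q _)) (trans (*-congʳ rq≈p)
      (trans (*-comm p _) (inverse p#0 .proj₂)))

    Spl-≐ : Spl closure (cubic M a) ≐ Spl closure (cubic M b)
    Spl-≐ = SplittingField.Spl-transform closure a u (inverse d#0 .proj₂) rs≈1 rq≈p

    -- Since rq = p, the product bq² equals p³, so `eval (E a x) u` is (b - x)q² and its factor b -
    -- x is apart from 0.
    b#x : ∀ {x} → eval (E a x) u # 0# → b # x
    b#x {x} e#0 = x-y#0⇒x#y (xy#0⇒x#0 (#-congʳ (begin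
      eval (E a x) u                      ≈⟨ eval-E a u x ⟩
      p * (p * p) - x * (q * q)           ≈⟨ +-congʳ (*-congˡ (*-cong rq≈p rq≈p)) ⟨
      p * ((r * q) * (r * q)) - x * (q * q)
        ≈⟨ solve 4 (λ p q r x → p :* ((r :* q) :* (r :* q)) :- x :* (q :* q) :=
                                (p :* (r :* r) :- x) :* (q :* q)) refl p q r x ⟩
      (b - x) * (q * q)                   ∎) e#0))
      where
      open ≈-Reasoning setoid
      open IntegerCoefficients commutativeRing using (solve; _:=_; _:*_; _:-_)

  conclude : ∃[ u ] ((((_ × eval (P a) u # 0#) × eval (Q a) u # 0#) × eval (D a) u # 0#) ×
               All (λ x → eval (E a x) u # 0#) xs) × All (u #_) [] →
             ∃[ b ] Spl closure (cubic M a) ≐ Spl closure (cubic M b) × All (b #_) xs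
  conclude (u , ((((_ , p#0) , q#0) , d#0) , e#0) , _) =
    b p#0 q#0 d#0 , Spl-≐ p#0 q#0 d#0 , All.map (b#x p#0 q#0 d#0) e#0
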